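{- Let $L=(L;\wedge,\vee,{}^\ast,{}^\prime,0,1)$ be a pseudocomplemented de Morgan algebra and let $(P;\tau,\leq,\zeta)$ be its dual $pm$-space. Then $L$ is regular if and only if the poset $(P;\leq)$ has height at most $1$, i.e. every chain in $(P;\leq)$ has at most $2$ elements.
   Context: A pseudocomplemented de Morgan algebra ($pm$-algebra) is an algebra $(L;\wedge,\vee,{}^\ast,{}^\prime,0,1)$ such that $(L;\wedge,\vee,0,1)$ is a bounded distributive lattice, ${}^\ast$ is the pseudocomplement ($x\wedge y=0$ iff $y\le x^\ast$), and ${}^\prime$ is a de Morgan involution ($(x\vee y)'=x'\wedge y'$, $(x\wedge y)'=x'\vee y'$, $0'=1$, $1'=0$, $x''=x$). An algebra is regular if any two congruences on it having a common class are equal. A $pm$-space is $(P;\tau,\le,\zeta)$ where $(P;\tau,\le)$ is a Priestley space, $[X)$ is clopen for every clopen decreasing $X\subseteq P$, and $\zeta$ is a continuous order-reversing involution of $P$. The dual $pm$-space of $L$ is the set of prime ideals of $L$ ordered by inclusion, with the Priestley topology and $\zeta(I)=\{a\in L: a'\notin I\}$; $L$ is isomorphic to the algebra of clopen decreasing subsets of its dual space with $\cap,\cup,\emptyset,P$, $X^\ast=P\setminus[X)$ and $X'=P\setminus\zeta(X)$. -}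

module Defs where

open import Level using (Level; _⊔_; suc)
open import Data.Nat.Base using (ℕ)
open import Data.Fin.Base using (Fin)
open import Data.Product.Base using (∃; ∃₂; _×_; _,_; proj₁; proj₂)
open import Data.Sum.Base using (_⊎_; inj₁; inj₂; [_,_])
open import Relation.Nullary.Decidable.Core using (yes; no)
open import Relation.Unary using (Pred; _∈_; _∉_; _⊆_; _≐_)
open import Relation.Binary.Core using (Rel; _⇒_) renaming (_⇔_ to _⇔ᵣ_)
open import Relation.Binary.Bundles using (Poset)
open import Relation.Binary.Structures using (IsEquivalence)
open import Relation.Binary.PropositionalEquality.Core using (_≢_)
import Relation.Binary.Construct.NaturalOrder.Left as NaturalOrder
open import Algebra.Core using (Op₁; Op₂)
open import Algebra.Definitions using (Congruent₁; Congruent₂; Identity)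
open import Algebra.Lattice.Structures using (IsDistributiveLattice)
open import Function.Bundles using (_⇔_)
open import Axiom.ExcludedMiddle using (ExcludedMiddle)

------------------------------------------------------------------------
-- Posets

module _ {a ℓ₁ ℓ₂ : Level} (P : Poset a ℓ₁ ℓ₂) where
  open Poset P

  IsChain : {p : Level} → Pred Carrier p → Set (a ⊔ ℓ₂ ⊔ p)
  IsChain C = ∀ {x y} → x ∈ C → y ∈ C → x ≤ y ⊎ y ≤ x

  -- Any n + 1 members, listed by Fin (suc n), contain a repetition.
  HasAtMost : {p : Level} → ℕ → Pred Carrier p → Set (a ⊔ ℓ₁ ⊔ p)
  HasAtMost n C = (f : Fin (ℕ.suc n) → Carrier) → (∀ i → f i ∈ C) →
                  ∃₂ λ i j → i ≢ j × f i ≈ f j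

  HeightAtMost : ℕ → Set (suc (a ⊔ ℓ₁ ⊔ ℓ₂))
  HeightAtMost n = (C : Pred Carrier (a ⊔ ℓ₁ ⊔ ℓ₂)) →
                   IsChain C → HasAtMost (ℕ.suc n) C

  UpperBound : {p : Level} → Pred Carrier p → Pred Carrier (a ⊔ ℓ₂ ⊔ p)
  UpperBound C u = ∀ {x} → x ∈ C → x ≤ u

  Maximal : Pred Carrier (a ⊔ ℓ₁ ⊔ ℓ₂)
  Maximal m = ∀ x → m ≤ x → m ≈ x

-- Agda has no choice principle, so the existence of enough prime ideals
-- is not derivable; choice is assumed explicitly in this form.
ZornsLemma : (a ℓ₁ ℓ₂ : Level) → Set (suc (a ⊔ ℓ₁ ⊔ ℓ₂))
ZornsLemma a ℓ₁ ℓ₂ =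
  (P : Poset a ℓ₁ ℓ₂) →
  ((C : Pred (Poset.Carrier P) (a ⊔ ℓ₁ ⊔ ℓ₂)) → IsChain P C → ∃ (UpperBound P C)) →
  ∃ (Maximal P)

------------------------------------------------------------------------
-- Pseudocomplemented de Morgan algebras

record PMAlgebra (c ℓ : Level) : Set (suc (c ⊔ ℓ)) where
  infix  8 _* _′
  infixr 7 _∧_
  infixr 6 _∨_
  infix  4 _≈_
  field
    Carrier : Set c
    _≈_     : Rel Carrier ℓ
    _∧_     : Op₂ Carrier
    _∨_     : Op₂ Carrier
    _*      : Op₁ Carrier
    _′      : Op₁ Carrier
    0#      : Carrier
    1#      : Carrier

  -- x ≤ y is x ≈ x ∧ y
  open NaturalOrder _≈_ _∧_ public using (_≤_)

  field
    isDistributiveLattice : IsDistributiveLattice _≈_ _∨_ _∧_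
    ∨-identity            : Identity _≈_ 0# _∨_
    ∧-identity            : Identity _≈_ 1# _∧_
    *-cong                : Congruent₁ _≈_ _*
    *-pseudocomplement    : ∀ x y → (x ∧ y ≈ 0#) ⇔ (y ≤ x *)
    ′-cong                : Congruent₁ _≈_ _′
    ′-∨                   : ∀ x y → (x ∨ y) ′ ≈ x ′ ∧ y ′
    ′-∧                   : ∀ x y → (x ∧ y) ′ ≈ x ′ ∨ y ′
    0′≈1                  : 0# ′ ≈ 1#
    1′≈0                  : 1# ′ ≈ 0#
    ′-involutive          : ∀ x → x ′ ′ ≈ x

  open IsDistributiveLattice isDistributiveLattice public

------------------------------------------------------------------------
-- Congruences and regularity

module _ {c ℓ : Level} (L : PMAlgebra c ℓ) where
  open PMAlgebra L

  -- The algebra is a setoid, so a congruence contains _≈_.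
  record Congruence : Set (suc (c ⊔ ℓ)) where
    field
      rel           : Rel Carrier (c ⊔ ℓ)
      equivalence   : IsEquivalence rel
      ≈⇒rel         : _≈_ ⇒ rel
      ∧-compatible  : Congruent₂ rel _∧_
      ∨-compatible  : Congruent₂ rel _∨_
      *-compatible  : Congruent₁ rel _*
      ′-compatible  : Congruent₁ rel _′

    class : Carrier → Pred Carrier (c ⊔ ℓ)
    class a = rel a

  -- The common class is allowed to have different representatives a and b.
  Regular : Set (suc (c ⊔ ℓ))
  Regular = (θ φ : Congruence) →
            (∃₂ λ a b → Congruence.class θ a ≐ Congruence.class φ b) →
            Congruence.rel θ ⇔ᵣ Congruence.rel φ

------------------------------------------------------------------------
-- Prime ideals

  record PrimeIdeal : Set (suc (c ⊔ ℓ)) where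
    field
      ideal    : Pred Carrier (c ⊔ ℓ)
      0∈       : 0# ∈ ideal
      ↓-closed : ∀ {x y} → x ≤ y → y ∈ ideal → x ∈ ideal
      ∨-closed : ∀ {x y} → x ∈ ideal → y ∈ ideal → x ∨ y ∈ ideal
      1∉       : 1# ∉ ideal
      prime    : ∀ {x y} → x ∧ y ∈ ideal → x ∈ ideal ⊎ y ∈ ideal

    ≈-closed : ∀ {x y} → x ≈ y → y ∈ ideal → x ∈ ideal
    ≈-closed {x} x≈y = ↓-closed
      (trans (sym (∧-absorbs-∨ x 0#)) (∧-cong refl (trans (proj₂ ∨-identity x) x≈y)))

  open PrimeIdeal

  primeIdealPoset : Poset (suc (c ⊔ ℓ)) (c ⊔ ℓ) (c ⊔ ℓ)
  primeIdealPoset = record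
    { Carrier        = PrimeIdeal
    ; _≈_            = λ I J → ideal I ≐ ideal J
    ; _≤_            = λ I J → ideal I ⊆ ideal J
    ; isPartialOrder = record
      { isPreorder = record
        { isEquivalence = record
          { refl  = (λ x∈ → x∈) , (λ x∈ → x∈)
          ; sym   = λ (f , g) → g , f
          ; trans = λ (f , g) (h , k) → (λ x∈ → h (f x∈)) , (λ x∈ → g (k x∈))
          }
        ; reflexive = proj₁
        ; trans     = λ f g x∈ → g (f x∈)
        }
      ; antisym = _,_
      }
    }

  -- The sets { J ∣ a ∉ J , b ∈ J } form a base: by primeness and closure
  -- under ∨, finitely many conditions aᵢ ∉ J and bⱼ ∈ J amount to
  -- ⋀ aᵢ ∉ J and ⋁ bⱼ ∈ J.
  PriestleyOpen : Pred (Pred PrimeIdeal (suc (c ⊔ ℓ))) (suc (c ⊔ ℓ))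
  PriestleyOpen U = ∀ I → I ∈ U →
    ∃₂ λ a b → a ∉ ideal I × b ∈ ideal I ×
               (∀ J → a ∉ ideal J → b ∈ ideal J → J ∈ U)

  -- Excluded middle is needed for primeness of { a ∣ a ′ ∉ I }.
  ζ-dual : ExcludedMiddle (c ⊔ ℓ) → PrimeIdeal → PrimeIdeal
  ζ-dual em I = record
    { ideal    = λ a → a ′ ∉ ideal I
    ; 0∈       = λ 0′∈ → 1∉ I (≈-closed I (sym 0′≈1) 0′∈)
    ; ↓-closed = λ x≤y y′∉ x′∈ → y′∉ (↓-closed I (′-antitone x≤y) x′∈)
    ; ∨-closed = λ {x} {y} x′∉ y′∉ xy′∈ →
        [ x′∉ , y′∉ ] (prime I (≈-closed I (sym (′-∨ x y)) xy′∈))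
    ; 1∉       = λ 1′∉ → 1′∉ (≈-closed I 1′≈0 (0∈ I))
    ; prime    = prime′
    }
    where
    ′-antitone : ∀ {x y} → x ≤ y → y ′ ≤ x ′
    ′-antitone {x} {y} x≤y = sym (trans
      (∧-cong refl (trans (′-cong x≤y) (trans (′-∧ x y) (∨-comm (x ′) (y ′)))))
      (∧-absorbs-∨ (y ′) (x ′)))

    prime′ : ∀ {x y} → (x ∧ y) ′ ∉ ideal I → x ′ ∉ ideal I ⊎ y ′ ∉ ideal I
    prime′ {x} {y} xy′∉ with em {P = x ′ ∈ ideal I}
    ... | no  x′∉ = inj₁ x′∉
    ... | yes x′∈ = inj₂ λ y′∈ → xy′∉ (≈-closed I (′-∧ x y) (∨-closed I x′∈ y′∈))

------------------------------------------------------------------------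
-- The dual space (P; τ, ≤, ζ)

-- The data of a pm-space.
record PMSpaceData (a ℓ₁ ℓ₂ : Level) : Set (suc (a ⊔ ℓ₁ ⊔ ℓ₂)) where
  field
    poset : Poset a ℓ₁ ℓ₂
    Open  : Pred (Pred (Poset.Carrier poset) a) a
    ζ     : Op₁ (Poset.Carrier poset)

dualSpace : {c ℓ : Level} → ExcludedMiddle (c ⊔ ℓ) → PMAlgebra c ℓ →
            PMSpaceData (suc (c ⊔ ℓ)) (c ⊔ ℓ) (c ⊔ ℓ)
dualSpace em L = record
  { poset = primeIdealPoset L
  ; Open  = PriestleyOpen L
  ; ζ     = ζ-dual L em
  }

{-# OPTIONS --safe #-}

-- Write x ⁺ = x ′ * ′ for the dual pseudocomplement.  Both sides are equivalent
-- to the identity  x ∧ x ⁺ ≤ y ∨ y *.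
--
-- Regularity gives the identity: the congruence "a * ≈ b * and a ⁺ ≈ b ⁺" has
-- { 1 } as a class, so it is equality, and it relates (x ∧ x ⁺) ∨ (y ∨ y *) to
-- y ∨ y *.  Conversely, any class of a congruence determines the class of 0,
-- since w ≡ 0 iff z ∨ w ≡ z and z ∧ w * ≡ z; and under the identity, which passes
-- to quotients, x ∧ y * ≡ 0 and y ′ ∧ x ′ * ≡ 0 imply x ≤ y modulo the congruence.
--
-- For prime ideals I ⊂ J ⊂ K, elements y ∈ J ∖ I and x ∈ K ∖ J violate the identity,
-- because y ∨ y * ∈ J and x ∧ x ⁺ ∉ J.  Conversely, if the identity fails at x, y,
-- a prime ideal J containing y ∨ y * but not x ∧ x ⁺ has a prime ideal strictly
-- below it and, applying ζ, one strictly above it.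
module Submission where

open import Defs
open import Level using (Level; _⊔_; Lift; lift; lower) renaming (suc to lsuc)
open import Data.Empty using (⊥-elim)
open import Data.Fin.Base using (Fin; zero; suc)
open import Data.Product.Base using (∃; ∃₂; _×_; _,_; proj₁; proj₂; swap)
open import Data.Sum.Base using (_⊎_; inj₁; inj₂; [_,_])
open import Function.Base using (_∘_; id)
open import Function.Bundles using (_⇔_; mk⇔; Equivalence)
open import Relation.Nullary using (¬_; yes; no; contradiction)
open import Relation.Nullary.Decidable using (True; toWitness; fromWitness; decidable-stable)
open import Relation.Unary using (Pred; _∈_; _∉_; _⊆_; _≐_)
open import Relation.Binary.Core using (_⇒_)
open import Relation.Binary.Bundles using (Poset)
open import Relation.Binary.Structures using (IsEquivalence)
open import Relation.Binary.PropositionalEquality.Core using (_≡_; _≢_)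
  renaming (refl to ≡-refl)
open import Relation.Binary.Lattice.Structures using (IsLattice)
open import Axiom.ExcludedMiddle using (ExcludedMiddle)
open import Algebra.Lattice.Bundles using (Lattice)
import Algebra.Lattice.Properties.Lattice as LatticeProperties

-- Height at most 1 and chains of three elements.

module _ {a ℓ₁ ℓ₂ : Level} (P : Poset a ℓ₁ ℓ₂) where
  open Poset P

  NoThreeChain : Set (a ⊔ ℓ₁ ⊔ ℓ₂)
  NoThreeChain = ∀ {x y z} → x ≤ y → y ≤ z → x ≈ y ⊎ y ≈ z

  heightAtMost-1⇒noThreeChain : HeightAtMost P 1 → NoThreeChain
  heightAtMost-1⇒noThreeChain height {x} {y} {z} x≤y y≤z =
    repetition (height C C-chain f λ i → lift (i , ≡-refl))
    where
    f : Fin 3 → Carrier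
    f zero             = x
    f (suc zero)       = y
    f (suc (suc zero)) = z

    -- Membership by `≡` lets matching on `≡-refl` reduce comparability in `C` to the indices.
    C : Pred Carrier (a ⊔ ℓ₁ ⊔ ℓ₂)
    C u = Lift (a ⊔ ℓ₁ ⊔ ℓ₂) (∃ λ i → u ≡ f i)

    f-chain : ∀ i j → f i ≤ f j ⊎ f j ≤ f i
    f-chain zero             zero             = inj₁ (reflexive Eq.refl)
    f-chain zero             (suc zero)       = inj₁ x≤y
    f-chain zero             (suc (suc zero)) = inj₁ (trans x≤y y≤z)
    f-chain (suc zero)       zero             = inj₂ x≤y
    f-chain (suc zero)       (suc zero)       = inj₁ (reflexive Eq.refl)
    f-chain (suc zero)       (suc (suc zero)) = inj₁ y≤z
    f-chain (suc (suc zero)) zero             = inj₂ (trans x≤y y≤z)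
    f-chain (suc (suc zero)) (suc zero)       = inj₂ y≤z
    f-chain (suc (suc zero)) (suc (suc zero)) = inj₁ (reflexive Eq.refl)

    C-chain : IsChain P C
    C-chain (lift (i , ≡-refl)) (lift (j , ≡-refl)) = f-chain i j

    -- If the two ends coincide, the chain collapses.
    x≈z⇒x≈y : x ≈ z → x ≈ y
    x≈z⇒x≈y x≈z = antisym x≤y (trans y≤z (reflexive (Eq.sym x≈z)))

    repetition : (∃₂ λ i j → i ≢ j × f i ≈ f j) → x ≈ y ⊎ y ≈ z
    repetition (zero , zero , i≢j , _) = contradiction ≡-refl i≢j
    repetition (zero , suc zero , _ , x≈y) = inj₁ x≈y
    repetition (zero , suc (suc zero) , _ , x≈z) = inj₁ (x≈z⇒x≈y x≈z)
    repetition (suc zero , zero , _ , y≈x) = inj₁ (Eq.sym y≈x)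
    repetition (suc zero , suc zero , i≢j , _) = contradiction ≡-refl i≢j
    repetition (suc zero , suc (suc zero) , _ , y≈z) = inj₂ y≈z
    repetition (suc (suc zero) , zero , _ , z≈x) = inj₁ (x≈z⇒x≈y (Eq.sym z≈x))
    repetition (suc (suc zero) , suc zero , _ , z≈y) = inj₂ (Eq.sym z≈y)
    repetition (suc (suc zero) , suc (suc zero) , i≢j , _) = contradiction ≡-refl i≢j

  noThreeChain⇒repetition : NoThreeChain → ∀ {n} (f : Fin n → Carrier) i j k →
    i ≢ j → j ≢ k → f i ≤ f j → f j ≤ f k → ∃₂ λ i j → i ≢ j × f i ≈ f j
  noThreeChain⇒repetition noChain f i j k i≢j j≢k fi≤fj fj≤fk =
    [ (λ fi≈fj → i , j , i≢j , fi≈fj) , (λ fj≈fk → j , k , j≢k , fj≈fk) ] (noChain fi≤fj fj≤fk)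

  -- The pairwise comparisons sort the three values; each case passes the indices in increasing
  -- order of value.
  noThreeChain⇒heightAtMost-1 : NoThreeChain → HeightAtMost P 1
  noThreeChain⇒heightAtMost-1 noChain C C-chain f f∈C
    with C-chain (f∈C zero) (f∈C (suc zero))
       | C-chain (f∈C (suc zero)) (f∈C (suc (suc zero)))
       | C-chain (f∈C zero) (f∈C (suc (suc zero)))
  ... | inj₁ x≤y | inj₁ y≤z | _ =
    noThreeChain⇒repetition noChain f zero (suc zero) (suc (suc zero)) (λ ()) (λ ()) x≤y y≤z
  ... | inj₁ x≤y | inj₂ z≤y | inj₁ x≤z =
    noThreeChain⇒repetition noChain f zero (suc (suc zero)) (suc zero) (λ ()) (λ ()) x≤z z≤y
  ... | inj₁ x≤y | inj₂ z≤y | inj₂ z≤x =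
    noThreeChain⇒repetition noChain f (suc (suc zero)) zero (suc zero) (λ ()) (λ ()) z≤x x≤y
  ... | inj₂ y≤x | inj₁ y≤z | inj₁ x≤z =
    noThreeChain⇒repetition noChain f (suc zero) zero (suc (suc zero)) (λ ()) (λ ()) y≤x x≤z
  ... | inj₂ y≤x | inj₁ y≤z | inj₂ z≤x =
    noThreeChain⇒repetition noChain f (suc zero) (suc (suc zero)) zero (λ ()) (λ ()) y≤z z≤x
  ... | inj₂ y≤x | inj₂ z≤y | _ =
    noThreeChain⇒repetition noChain f (suc (suc zero)) (suc zero) zero (λ ()) (λ ()) z≤y y≤x

-- Arithmetic of the pseudocomplement and its dual.

module PMAlgebraProperties {c ℓ : Level} (L : PMAlgebra c ℓ) where
  open PMAlgebra L

  lattice : Lattice c ℓ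
  lattice = record { isLattice = isLattice }

  open LatticeProperties lattice public using (∨-∧-isOrderTheoreticLattice)
  open IsLattice ∨-∧-isOrderTheoreticLattice public
    using (x≤x∨y; y≤x∨y; ∨-least; x∧y≤x; x∧y≤y; ∧-greatest)
    renaming ( refl to ≤-refl; reflexive to ≤-reflexive; trans to ≤-trans
             ; antisym to ≤-antisym)

  infix 8 _⁺
  _⁺ : Carrier → Carrier
  x ⁺ = x ′ * ′

  0≤x : ∀ x → 0# ≤ x
  0≤x x = ≤-trans (x≤x∨y 0# x) (≤-reflexive (proj₁ ∨-identity x))

  x≤1 : ∀ x → x ≤ 1#
  x≤1 x = sym (proj₂ ∧-identity x)

  x≤0⇒x≈0 : ∀ {x} → x ≤ 0# → x ≈ 0#
  x≤0⇒x≈0 x≤0 = ≤-antisym x≤0 (0≤x _)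

  ∧-mono : ∀ {x y u v} → x ≤ y → u ≤ v → x ∧ u ≤ y ∧ v
  ∧-mono x≤y u≤v = ∧-greatest (≤-trans (x∧y≤x _ _) x≤y) (≤-trans (x∧y≤y _ _) u≤v)

  ∨-mono : ∀ {x y u v} → x ≤ y → u ≤ v → x ∨ u ≤ y ∨ v
  ∨-mono x≤y u≤v = ∨-least (≤-trans x≤y (x≤x∨y _ _)) (≤-trans u≤v (y≤x∨y _ _))

  x∨y≈y⇒x≤y : ∀ {x y} → x ∨ y ≈ y → x ≤ y
  x∨y≈y⇒x≤y x∨y≈y = ≤-trans (x≤x∨y _ _) (≤-reflexive x∨y≈y)

  ∧-distribˡ-∨-≤ : ∀ x y z → x ∧ (y ∨ z) ≤ x ∧ y ∨ x ∧ z
  ∧-distribˡ-∨-≤ x y z = ≤-reflexive (proj₁ ∧-distrib-∨ x y z)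

  disjoint⇒≤* : ∀ {x y} → x ∧ y ≤ 0# → y ≤ x *
  disjoint⇒≤* x∧y≤0 = Equivalence.to (*-pseudocomplement _ _) (x≤0⇒x≈0 x∧y≤0)

  ≤*⇒disjoint : ∀ {x y} → y ≤ x * → x ∧ y ≤ 0#
  ≤*⇒disjoint y≤x* = ≤-reflexive (Equivalence.from (*-pseudocomplement _ _) y≤x*)

  x∧x*≤0 : ∀ x → x ∧ x * ≤ 0#
  x∧x*≤0 x = ≤*⇒disjoint ≤-refl

  *-antitone : ∀ {x y} → x ≤ y → y * ≤ x *
  *-antitone x≤y = disjoint⇒≤* (≤-trans (∧-mono x≤y ≤-refl) (x∧x*≤0 _))

  1≤0* : 1# ≤ 0# *
  1≤0* = disjoint⇒≤* (x∧y≤x 0# 1#)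

  -- That is, `x ∨ x *` is dense: its pseudocomplement lies below both `x *` and `x * *`.
  [x∨x*]*≤0 : ∀ x → (x ∨ x *) * ≤ 0#
  [x∨x*]*≤0 x = ≤-trans
    (∧-greatest (*-antitone (x≤x∨y _ _)) (*-antitone (y≤x∨y _ _)))
    (x∧x*≤0 (x *))

  -- The element `z ∧ (x ∧ z) *` is disjoint from `x`, so it lies below `x *`, hence below `y *`,
  -- and is disjoint from `y`.
  *-∧-monoˡ : ∀ {x y} z → x * ≤ y * → (x ∧ z) * ≤ (y ∧ z) *
  *-∧-monoˡ {x} {y} z x*≤y* = disjoint⇒≤* (≤-trans
    (≤-reflexive (∧-assoc y z _))
    (≤*⇒disjoint (≤-trans
      (disjoint⇒≤* (≤-trans (≤-reflexive (sym (∧-assoc x z _))) (x∧x*≤0 _)))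
      x*≤y*)))

  *-∧-mono : ∀ {x y u v} → x * ≤ y * → u * ≤ v * → (x ∧ u) * ≤ (y ∧ v) *
  *-∧-mono {x} {y} {u} {v} x*≤y* u*≤v* =
    ≤-trans (*-∧-monoˡ u x*≤y*)
    (≤-trans (≤-reflexive (*-cong (∧-comm y u)))
    (≤-trans (*-∧-monoˡ y u*≤v*)
             (≤-reflexive (*-cong (∧-comm v y)))))

  *-∨-mono : ∀ {x y u v} → x * ≤ y * → u * ≤ v * → (x ∨ u) * ≤ (y ∨ v) *
  *-∨-mono {x} {y} {u} {v} x*≤y* u*≤v* = disjoint⇒≤* (≤-trans
    (≤-reflexive (proj₂ ∧-distrib-∨ _ y v))
    (∨-least (≤*⇒disjoint (≤-trans (*-antitone (x≤x∨y x u)) x*≤y*))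
             (≤*⇒disjoint (≤-trans (*-antitone (y≤x∨y x u)) u*≤v*))))

  ′-antitone : ∀ {x y} → x ≤ y → y ′ ≤ x ′
  ′-antitone {x} {y} x≤y = ≤-trans (y≤x∨y (x ′) (y ′))
    (≤-reflexive (sym (trans (′-cong x≤y) (′-∧ x y))))

  -- The image of `x ′ ∧ x ′ * ≤ 0#` under the involution.
  1≤x∨x⁺ : ∀ x → 1# ≤ x ∨ x ⁺
  1≤x∨x⁺ x = ≤-trans (≤-reflexive (sym 0′≈1)) (≤-trans (′-antitone (x∧x*≤0 (x ′)))
    (≤-trans (≤-reflexive (′-∧ (x ′) (x ′ *))) (∨-mono (≤-reflexive (′-involutive x)) ≤-refl)))

  Identity : Set (c ⊔ ℓ)
  Identity = ∀ x y → x ∧ x ⁺ ≤ y ∨ y *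

  -- First split `x` along `y ∨ y ⁺`: the second hypothesis gives `y ⁺ ≤ x ⁺`, so the identity puts
  -- `x ∧ y ⁺` below `y ∨ y *`. Then split `x` along `y ∨ y *`, where the part under `y *` vanishes.
  -- Both hypotheses only say that an element is 0, so in a quotient the class of 0 decides them.
  identity⇒≤ : Identity → ∀ {x y} → x ∧ y * ≤ 0# → y ′ ∧ x ′ * ≤ 0# → x ≤ y
  identity⇒≤ identity {x} {y} x∧y*≤0 y′∧x′*≤0 =
    cover x≤y∨y* (x∧y≤y _ _) (≤-trans x∧y*≤0 (0≤x y))
    where
    cover : ∀ {u v w} → x ≤ u ∨ v → x ∧ u ≤ w → x ∧ v ≤ w → x ≤ w
    cover x≤u∨v xu≤w xv≤w = ≤-trans (∧-greatest ≤-refl x≤u∨v)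
      (≤-trans (∧-distribˡ-∨-≤ _ _ _) (∨-least xu≤w xv≤w))

    y⁺≤x⁺ : y ⁺ ≤ x ⁺
    y⁺≤x⁺ = ′-antitone (disjoint⇒≤* y′∧x′*≤0)

    x≤y∨y* : x ≤ y ∨ y *
    x≤y∨y* = cover (≤-trans (x≤1 x) (1≤x∨x⁺ y))
      (≤-trans (x∧y≤y x y) (x≤x∨y y (y *)))
      (≤-trans (∧-mono ≤-refl y⁺≤x⁺) (identity x y))

  -- The hypotheses amount to `w ≤ z ≤ w *`, which makes `w` disjoint from itself.
  z∨w≈z∧z∧w*≈z⇒w≈0 : ∀ {z w} → z ∨ w ≈ z → z ∧ w * ≈ z → w ≈ 0#
  z∨w≈z∧z∧w*≈z⇒w≈0 {z} {w} z∨w≈z z∧w*≈z = x≤0⇒x≈0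
    (≤-trans (∧-greatest ≤-refl (≤-trans w≤z z≤w*)) (x∧x*≤0 w))
    where
    w≤z : w ≤ z
    w≤z = ≤-trans (y≤x∨y z w) (≤-reflexive z∨w≈z)

    z≤w* : z ≤ w *
    z≤w* = ≤-trans (≤-reflexive (sym z∧w*≈z)) (x∧y≤y _ _)

  -- Quotient algebras.

  module _ (θ : Congruence L) where
    open Congruence θ
    open IsEquivalence equivalence
      renaming (refl to θ-refl; sym to θ-sym; trans to θ-trans)

    -- The carrier stays and `rel` becomes the equality, so the arithmetic above applies modulo `θ`.
    -- Equations transfer at once; the biconditional for `*` needs an argument.
    quotient : PMAlgebra c (c ⊔ ℓ)
    quotient = record
      { Carrier = Carrier
      ; _≈_     = rel
      ; _∧_     = _∧_
      ; _∨_     = _∨_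
      ; _*      = _*
      ; _′      = _′
      ; 0#      = 0#
      ; 1#      = 1#
      ; isDistributiveLattice = record
        { isLattice = record
          { isEquivalence = equivalence
          ; ∨-comm        = λ x y → ≈⇒rel (∨-comm x y)
          ; ∨-assoc       = λ x y z → ≈⇒rel (∨-assoc x y z)
          ; ∨-cong        = ∨-compatible
          ; ∧-comm        = λ x y → ≈⇒rel (∧-comm x y)
          ; ∧-assoc       = λ x y z → ≈⇒rel (∧-assoc x y z)
          ; ∧-cong        = ∧-compatible
          ; absorptive    = (λ x y → ≈⇒rel (∨-absorbs-∧ x y))
                          , (λ x y → ≈⇒rel (∧-absorbs-∨ x y))
          }
        ; ∨-distrib-∧ = (λ x y z → ≈⇒rel (proj₁ ∨-distrib-∧ x y z))
                      , (λ x y z → ≈⇒rel (proj₂ ∨-distrib-∧ x y z))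
        ; ∧-distrib-∨ = (λ x y z → ≈⇒rel (proj₁ ∧-distrib-∨ x y z))
                      , (λ x y z → ≈⇒rel (proj₂ ∧-distrib-∨ x y z))
        }
      ; ∨-identity = (λ x → ≈⇒rel (proj₁ ∨-identity x)) , (λ x → ≈⇒rel (proj₂ ∨-identity x))
      ; ∧-identity = (λ x → ≈⇒rel (proj₁ ∧-identity x)) , (λ x → ≈⇒rel (proj₂ ∧-identity x))
      ; *-cong     = *-compatible
      ; *-pseudocomplement = λ x y → mk⇔ (to x y) (from x y)
      ; ′-cong     = ′-compatible
      ; ′-∨        = λ x y → ≈⇒rel (′-∨ x y)
      ; ′-∧        = λ x y → ≈⇒rel (′-∧ x y)
      ; 0′≈1       = ≈⇒rel 0′≈1
      ; 1′≈0       = ≈⇒rel 1′≈0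
      ; ′-involutive = λ x → ≈⇒rel (′-involutive x)
      }
      where
      -- The nontrivial half of an equation that expresses the pseudocomplement law equationally and
      -- so survives in the quotient.
      y∧[x∧y]*≤y∧x* : ∀ x y → y ∧ (x ∧ y) * ≤ y ∧ x *
      y∧[x∧y]*≤y∧x* x y = ∧-greatest (x∧y≤x _ _) (disjoint⇒≤*
        (≤-trans (≤-reflexive (sym (∧-assoc x y _))) (x∧x*≤0 (x ∧ y))))

      -- Modulo θ, y ≡ y ∧ 0 * ≡ y ∧ (x ∧ y) * = y ∧ x *.
      to : ∀ x y → rel (x ∧ y) 0# → rel y (y ∧ x *)
      to x y x∧yθ0 = θ-trans (≈⇒rel (≤-trans (x≤1 y) 1≤0*))
        (θ-trans (∧-compatible θ-refl (*-compatible (θ-sym x∧yθ0)))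
          (≈⇒rel (≤-antisym (y∧[x∧y]*≤y∧x* x y)
            (∧-mono ≤-refl (*-antitone (x∧y≤x x y))))))

      from : ∀ x y → rel y (y ∧ x *) → rel (x ∧ y) 0#
      from x y yθ = θ-trans (∧-compatible θ-refl yθ) (≈⇒rel (x≤0⇒x≈0
        (≤*⇒disjoint (x∧y≤y y (x *)))))

  -- The determination congruence and the identity.

  equality : Congruence L
  equality = record
    { rel          = λ x y → Lift (c ⊔ ℓ) (x ≈ y)
    ; equivalence  = record
      { refl  = lift refl
      ; sym   = λ (lift e) → lift (sym e)
      ; trans = λ (lift e) (lift f) → lift (trans e f)
      }
    ; ≈⇒rel        = lift
    ; ∧-compatible = λ (lift e) (lift f) → lift (∧-cong e f)
    ; ∨-compatible = λ (lift e) (lift f) → lift (∨-cong e f)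
    ; *-compatible = λ (lift e) → lift (*-cong e)
    ; ′-compatible = λ (lift e) → lift (′-cong e)
    }

  -- The condition `x ⁺ ≈ y ⁺` appears without its outer `′`, so that `′` merely interchanges the
  -- two components.
  determination : Congruence L
  determination = record
    { rel          = λ x y → Lift (c ⊔ ℓ) (x * ≈ y * × x ′ * ≈ y ′ *)
    ; equivalence  = record
      { refl  = lift (refl , refl)
      ; sym   = λ (lift (e , e′)) → lift (sym e , sym e′)
      ; trans = λ (lift (e , e′)) (lift (f , f′)) → lift (trans e f , trans e′ f′)
      }
    ; ≈⇒rel        = λ e → lift (*-cong e , *-cong (′-cong e))
    ; ∧-compatible = λ (lift (e , e′)) (lift (f , f′)) → lift
        ( *-∧-cong e f
        , trans (*-cong (′-∧ _ _)) (trans (*-∨-cong e′ f′) (*-cong (sym (′-∧ _ _)))))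
    ; ∨-compatible = λ (lift (e , e′)) (lift (f , f′)) → lift
        ( *-∨-cong e f
        , trans (*-cong (′-∨ _ _)) (trans (*-∧-cong e′ f′) (*-cong (sym (′-∨ _ _)))))
    ; *-compatible = λ (lift (e , e′)) → lift (*-cong e , *-cong (′-cong e))
    ; ′-compatible = λ (lift (e , e′)) → lift
        (e′ , trans (*-cong (′-involutive _)) (trans e (*-cong (sym (′-involutive _)))))
    }
    where
    *-∧-cong : ∀ {x y u v} → x * ≈ y * → u * ≈ v * → (x ∧ u) * ≈ (y ∧ v) *
    *-∧-cong e f = ≤-antisym (*-∧-mono (≤-reflexive e) (≤-reflexive f))
                             (*-∧-mono (≤-reflexive (sym e)) (≤-reflexive (sym f)))

    *-∨-cong : ∀ {x y u v} → x * ≈ y * → u * ≈ v * → (x ∨ u) * ≈ (y ∨ v) *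
    *-∨-cong e f = ≤-antisym (*-∨-mono (≤-reflexive e) (≤-reflexive f))
                             (*-∨-mono (≤-reflexive (sym e)) (≤-reflexive (sym f)))

  regular⇒identity : Regular L → Identity
  regular⇒identity regular x y =
    x∨y≈y⇒x≤y (lower (determination⊆equality (lift ([p∨q]*≈q* , [p∨q]′*≈q′*))))
    where
    -- Here `z ′ *` equals `1# ′ *`, which is 1, so `z ′` is disjoint from itself.
    class-of-1 : ∀ {z} → Congruence.class determination 1# z → Congruence.class equality 1# z
    class-of-1 {z} (lift (_ , 1′*≈z′*)) = lift (trans (sym 0′≈1)
      (trans (′-cong (sym z′≈0)) (′-involutive z)))
      where
      z′≤z′* : z ′ ≤ z ′ *
      z′≤z′* = ≤-trans (x≤1 _) (≤-trans 1≤0* (≤-reflexive (trans (*-cong (sym 1′≈0)) 1′*≈z′*)))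

      z′≈0 : z ′ ≈ 0#
      z′≈0 = x≤0⇒x≈0 (≤-trans (∧-greatest ≤-refl z′≤z′*) (x∧x*≤0 _))

    determination⊆equality : Congruence.rel determination ⇒ Congruence.rel equality
    determination⊆equality = proj₁ (regular determination equality
      (1# , 1# , class-of-1 , λ (lift e) → Congruence.≈⇒rel determination e))

    p q : Carrier
    p = x ∧ x ⁺
    q = y ∨ y *

    -- Both sides are 0 because `q` is dense.
    [p∨q]*≈q* : (p ∨ q) * ≈ q *
    [p∨q]*≈q* = ≤-antisym (*-antitone (y≤x∨y p q)) (≤-trans ([x∨x*]*≤0 y) (0≤x _))

    -- By de Morgan `p ′` is `x ′ ∨ x ′ *`, again a dense element.
    p′*≤0 : p ′ * ≤ 0#
    p′*≤0 = ≤-trans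
      (≤-reflexive (*-cong (trans (′-∧ x (x ⁺)) (∨-cong refl (′-involutive (x ′ *))))))
      ([x∨x*]*≤0 (x ′))

    [p∨q]′*≈q′* : (p ∨ q) ′ * ≈ q ′ *
    [p∨q]′*≈q′* = ≤-antisym
      (≤-trans (≤-reflexive (*-cong (′-∨ p q)))
      -- Under `*`, the dense factor `p ′` may be replaced by 1.
      (≤-trans (*-∧-monoˡ (q ′) (≤-trans p′*≤0 (0≤x (1# *))))
               (≤-reflexive (*-cong (proj₁ ∧-identity (q ′))))))
      (*-antitone (′-antitone (y≤x∨y p q)))

-- From the identity to regularity.

module _ {c ℓ : Level} (L : PMAlgebra c ℓ) where
  open PMAlgebra L
  open PMAlgebraProperties L

  -- Joining `a` with `w`, or meeting it with `w *`, stays in the `θ`-class of `a`, hence in one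
  -- `φ`-class with `a`. In the quotient by `φ` this forces `w` to be 0.
  common-class⇒0-class : (θ φ : Congruence L) →
    ∀ {a b} → Congruence.class θ a ⊆ Congruence.class φ b →
    ∀ {w} → Congruence.rel θ w 0# → Congruence.rel φ w 0#
  common-class⇒0-class θ φ {a} {b} θa⊆φb {w} wθ0 =
    PMAlgebraProperties.z∨w≈z∧z∧w*≈z⇒w≈0 (quotient φ)
      (φ.trans (φ.sym (θa⊆φb aθa∨w)) (θa⊆φb θ.refl))
      (φ.trans (φ.sym (θa⊆φb aθa∧w*)) (θa⊆φb θ.refl))
    where
    open Congruence θ
    module θ = PMAlgebra (quotient θ)
    module φ = PMAlgebra (quotient φ)

    aθa∨w : rel a (a ∨ w)
    aθa∨w = θ.sym (θ.trans (∨-compatible θ.refl wθ0) (≈⇒rel (proj₂ ∨-identity a)))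

    aθa∧w* : rel a (a ∧ w *)
    aθa∧w* = θ.trans (≈⇒rel (≤-trans (x≤1 a) 1≤0*))
                       (∧-compatible θ.refl (*-compatible (θ.sym wθ0)))

  identity⇒regular : Identity → Regular L
  identity⇒regular identity θ φ (a , b , θa⊆φb , φb⊆θa) =
    included θ φ (common-class⇒0-class θ φ θa⊆φb) ,
    included φ θ (common-class⇒0-class φ θ φb⊆θa)
    where
    included : (θ φ : Congruence L) →
      (∀ {w} → Congruence.rel θ w 0# → Congruence.rel φ w 0#) →
      Congruence.rel θ ⇒ Congruence.rel φ
    included θ φ 0-class {x} {y} xθy = Q.≤-antisym (≤-mod xθy) (≤-mod (θ.sym xθy))
      where
      open Congruence θ
      module θ = PMAlgebra (quotient θ)
      module Q = PMAlgebraProperties (quotient φ)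

      -- Under `θ`, `x ∧ y *` is congruent to `y ∧ y *` and `y ′ ∧ x ′ *` to `x ′ ∧ x ′ *`; both are
      -- 0, so `0-class` carries them to `φ`.
      ≤-mod : ∀ {x y} → rel x y → PMAlgebra._≤_ (quotient φ) x y
      ≤-mod {x} {y} xθy = Q.identity⇒≤ (λ u v → Congruence.≈⇒rel φ (identity u v))
        (Q.≤-reflexive (0-class (θ.trans (∧-compatible xθy θ.refl)
          (≈⇒rel (x≤0⇒x≈0 (x∧x*≤0 y))))))
        (Q.≤-reflexive (0-class (θ.trans (∧-compatible (′-compatible (θ.sym xθy)) θ.refl)
          (≈⇒rel (x≤0⇒x≈0 (x∧x*≤0 (x ′)))))))

-- Prime ideals from Zorn's lemma.

module _ (em : ∀ {a : Level} → ExcludedMiddle a)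
         (zorn : ∀ {a ℓ₁ ℓ₂ : Level} → ZornsLemma a ℓ₁ ℓ₂)
         {c ℓ : Level} (L : PMAlgebra c ℓ) where
  open PMAlgebra L
  open PMAlgebraProperties L
  open PrimeIdeal

  ⊆⊎witness : ∀ {p q} {A : Set c} (S : Pred A p) (T : Pred A q) →
              S ⊆ T ⊎ (∃ λ x → x ∈ S × x ∉ T)
  ⊆⊎witness S T with em {P = ∃ λ x → x ∈ S × x ∉ T}
  ... | yes w = inj₂ w
  ... | no ¬w = inj₁ λ {x} x∈S → decidable-stable em λ x∉T → ¬w (x , x∈S , x∉T)

  record IdealAvoiding (F : Pred Carrier (c ⊔ ℓ)) (a : Carrier) : Set (lsuc (c ⊔ ℓ)) where
    field
      member    : Pred Carrier (c ⊔ ℓ)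
      a∈member  : a ∈ member
      ↓-closed′ : ∀ {x y} → x ≤ y → y ∈ member → x ∈ member
      ∨-closed′ : ∀ {x y} → x ∈ member → y ∈ member → x ∨ y ∈ member
      avoids    : ∀ {x} → x ∈ F → x ∉ member

  module _ {F : Pred Carrier (c ⊔ ℓ)} {a : Carrier} where
    open IdealAvoiding

    idealPoset : Poset (lsuc (c ⊔ ℓ)) (c ⊔ ℓ) (c ⊔ ℓ)
    idealPoset = record
      { Carrier        = IdealAvoiding F a
      ; _≈_            = λ I J → member I ≐ member J
      ; _≤_            = λ I J → member I ⊆ member J
      ; isPartialOrder = record
        { isPreorder = record
          { isEquivalence = record
            { refl  = id , id
            ; sym   = swap
            ; trans = λ (f , g) (h , k) → h ∘ f , g ∘ k
            }
          ; reflexive = proj₁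
          ; trans     = λ f g → g ∘ f
          }
        ; antisym = _,_
        }
      }

    maximal-avoiding : (∀ {x} → x ∈ F → ¬ (x ≤ a)) → ∃ (Maximal idealPoset)
    maximal-avoiding F-avoids-a = zorn idealPoset λ C C-chain →
      union C C-chain , λ I∈C x∈I → lift (fromWitness (_ , inj₁ I∈C , x∈I))
      where
      -- The principal ideal of `a` is adjoined to every chain, so that the union contains `a` even
      -- for the empty chain.
      ↓a : IdealAvoiding F a
      ↓a = record
        { member    = λ x → Lift (c ⊔ ℓ) (x ≤ a)
        ; a∈member  = lift ≤-refl
        ; ↓-closed′ = λ x≤y (lift y≤a) → lift (≤-trans x≤y y≤a)
        ; ∨-closed′ = λ (lift x≤a) (lift y≤a) → lift (∨-least x≤a y≤a)
        ; avoids    = λ x∈F (lift x≤a) → F-avoids-a x∈F x≤a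
        }

      module _ (C : Pred (IdealAvoiding F a) (lsuc (c ⊔ ℓ))) (C-chain : IsChain idealPoset C) where
        InUnion : Pred Carrier (lsuc (c ⊔ ℓ))
        InUnion x = ∃ λ I → (I ∈ C ⊎ I ≡ ↓a) × x ∈ member I

        comparable : ∀ {I J} → I ∈ C ⊎ I ≡ ↓a → J ∈ C ⊎ J ≡ ↓a →
                     member I ⊆ member J ⊎ member J ⊆ member I
        comparable (inj₁ I∈C)            (inj₁ J∈C)    = C-chain I∈C J∈C
        comparable {J = J} (inj₂ ≡-refl) _             = inj₁ λ (lift x≤a) → ↓-closed′ J x≤a (a∈member J)
        comparable {I} _                 (inj₂ ≡-refl) = inj₂ λ (lift x≤a) → ↓-closed′ I x≤a (a∈member I)

        InUnion-∨ : ∀ {x y} → InUnion x → InUnion y → InUnion (x ∨ y)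
        InUnion-∨ (I , I∈ , x∈I) (J , J∈ , y∈J) with comparable I∈ J∈
        ... | inj₁ I⊆J = J , J∈ , ∨-closed′ J (I⊆J x∈I) y∈J
        ... | inj₂ J⊆I = I , I∈ , ∨-closed′ I x∈I (J⊆I y∈J)

        -- InUnion lives one universe too high; True em brings it down.
        union : IdealAvoiding F a
        union = record
          { member    = λ x → Lift (c ⊔ ℓ) (True (em {P = InUnion x}))
          ; a∈member  = lift (fromWitness (↓a , inj₂ ≡-refl , lift ≤-refl))
          ; ↓-closed′ = λ x≤y (lift y∈) → let (I , I∈ , y∈I) = toWitness y∈ in
                        lift (fromWitness (I , I∈ , ↓-closed′ I x≤y y∈I))
          ; ∨-closed′ = λ (lift x∈) (lift y∈) →
                        lift (fromWitness (InUnion-∨ (toWitness x∈) (toWitness y∈)))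
          ; avoids    = λ x∈F (lift x∈) → let (I , _ , x∈I) = toWitness x∈ in avoids I x∈F x∈I
          }

    module _ (F-∧ : ∀ {x y} → x ∈ F → y ∈ F → x ∧ y ∈ F)
             (M : IdealAvoiding F a) (M-maximal : Maximal idealPoset M) where

      -- The ideal generated by `M` and `x`; the premise is its disjointness from `F`.
      adjoin : (x : Carrier) →
               (∀ {m f} → m ∈ member M → f ∈ F → ¬ (f ≤ m ∨ x)) → IdealAvoiding F a
      adjoin x F-avoids = record
        { member    = λ z → ∃ λ m → m ∈ member M × z ≤ m ∨ x
        ; a∈member  = a , a∈member M , x≤x∨y a x
        ; ↓-closed′ = λ y≤z (m , m∈M , z≤) → m , m∈M , ≤-trans y≤z z≤
        ; ∨-closed′ = λ (m , m∈M , y≤) (n , n∈M , z≤) → m ∨ n , ∨-closed′ M m∈M n∈M ,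
            ∨-least (≤-trans y≤ (∨-mono (x≤x∨y m n) ≤-refl))
                    (≤-trans z≤ (∨-mono (y≤x∨y m n) ≤-refl))
        ; avoids    = λ f∈F (m , m∈M , f≤) → F-avoids m∈M f∈F f≤
        }

      -- Otherwise `adjoin` would give an ideal above `M` that contains `x`, and maximality would
      -- put `x` in `M`.
      ∉maximal⇒meets-F : ∀ {x} → x ∉ member M →
                         ∃₂ λ m f → m ∈ member M × f ∈ F × f ≤ m ∨ x
      ∉maximal⇒meets-F {x} x∉M = decidable-stable em λ none →
        let I = adjoin x λ m∈M f∈F f≤ → none (_ , _ , m∈M , f∈F , f≤) in
        x∉M (proj₂ (M-maximal I λ {z} z∈M → z , z∈M , x≤x∨y z x)
              (a , a∈member M , y≤x∨y a x))

      -- If both fail, some `f ≤ m ∨ x` and `g ≤ n ∨ y` lie in `F`. By distributivity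
      -- `f ∧ g ≤ (m ∨ n) ∨ (x ∧ y)`, so `M` meets `F`.
      maximal-prime : ∀ {x y} → x ∧ y ∈ member M → x ∈ member M ⊎ y ∈ member M
      maximal-prime {x} {y} x∧y∈M with em {P = x ∈ member M} | em {P = y ∈ member M}
      ... | yes x∈M | _       = inj₁ x∈M
      ... | _       | yes y∈M = inj₂ y∈M
      ... | no x∉M  | no y∉M  =
        let (m , f , m∈M , f∈F , f≤m∨x) = ∉maximal⇒meets-F x∉M
            (n , g , n∈M , g∈F , g≤n∨y) = ∉maximal⇒meets-F y∉M
            f≤ = ≤-trans f≤m∨x (∨-mono (x≤x∨y m n) ≤-refl)
            g≤ = ≤-trans g≤n∨y (∨-mono (y≤x∨y m n) ≤-refl)
        in ⊥-elim (avoids M (F-∧ f∈F g∈F) (↓-closed′ M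
             (≤-trans (∧-mono f≤ g≤) (≤-reflexive (sym (proj₁ ∨-distrib-∧ (m ∨ n) x y))))
             (∨-closed′ M (∨-closed′ M m∈M n∈M) x∧y∈M)))

  primeIdeal-avoiding : (F : Pred Carrier (c ⊔ ℓ)) →
    (∀ {x y} → x ∈ F → y ∈ F → x ∧ y ∈ F) → ∃ F →
    ∀ {a} → (∀ {x} → x ∈ F → ¬ (x ≤ a)) →
    ∃ λ (P : PrimeIdeal L) → a ∈ ideal P × (∀ {x} → x ∈ F → x ∉ ideal P)
  primeIdeal-avoiding F F-∧ (f , f∈F) {a} F-avoids-a =
    record
      { ideal    = member M
      ; 0∈       = ↓-closed′ M (0≤x a) (a∈member M)
      ; ↓-closed = ↓-closed′ M
      ; ∨-closed = ∨-closed′ M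
      -- An element of `F` keeps the ideal proper.
      ; 1∉       = λ 1∈M → avoids M f∈F (↓-closed′ M (x≤1 f) 1∈M)
      ; prime    = maximal-prime F-∧ M M-maximal
      } , a∈member M , avoids M
    where
    open IdealAvoiding
    M = proj₁ (maximal-avoiding F-avoids-a)
    M-maximal = proj₂ (maximal-avoiding F-avoids-a)

  -- Separation, and prime ideals below or above a given one.

  primeIdeal-separating : ∀ {x y} → ¬ (x ≤ y) →
    ∃ λ (J : PrimeIdeal L) → y ∈ ideal J × x ∉ ideal J
  primeIdeal-separating {x} x≰y =
    let (J , y∈J , J-avoids) = primeIdeal-avoiding (λ z → Lift (c ⊔ ℓ) (x ≤ z))
          (λ (lift x≤u) (lift x≤v) → lift (∧-greatest x≤u x≤v))
          (x , lift ≤-refl)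
          (λ (lift x≤u) u≤y → x≰y (≤-trans x≤u u≤y))
    in J , y∈J , J-avoids (lift ≤-refl)

  -- Avoid the filter generated by `y` and the complement of `J`. It misses 0: if `y ∧ d` is 0, then
  -- `d ≤ y *`, so `d` lies in `J`.
  primeIdeal-below : (J : PrimeIdeal L) → ∀ {y} → y ∨ y * ∈ ideal J →
    ∃ λ (I : PrimeIdeal L) → ideal I ⊆ ideal J × y ∉ ideal I
  primeIdeal-below J {y} y∨y*∈J =
    let (I , _ , I-avoids) = primeIdeal-avoiding F
          (λ (d , d∉J , yd≤u) (e , e∉J , ye≤v) → d ∧ e , [ d∉J , e∉J ] ∘ prime J ,
             ∧-greatest (≤-trans (∧-mono ≤-refl (x∧y≤x d e)) yd≤u)
                        (≤-trans (∧-mono ≤-refl (x∧y≤y d e)) ye≤v))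
          -- The choice `d = 1#` puts `y` itself into `F`.
          (y , 1# , 1∉ J , x∧y≤x y 1#)
          (λ (d , d∉J , yd≤u) u≤0 → d∉J (↓-closed J
             (≤-trans (disjoint⇒≤* (≤-trans yd≤u u≤0)) (y≤x∨y y (y *))) y∨y*∈J))
    in I , (λ {i} i∈I → decidable-stable em λ i∉J → I-avoids (i , i∉J , x∧y≤y y i) i∈I) ,
       I-avoids (1# , 1∉ J , x∧y≤x y 1#)
    where
    F : Pred Carrier (c ⊔ ℓ)
    F z = ∃ λ d → d ∉ ideal J × y ∧ d ≤ z

  -- The order-reversing `ζ` turns this into `primeIdeal-below` for the image of `J` and `x ′`:
  -- since `(x ′ ∨ x ′ *) ′` is `x ∧ x ⁺`, the premise puts `x ′ ∨ x ′ *` in that image.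
  primeIdeal-above : (J : PrimeIdeal L) → ∀ {x} → x ∧ x ⁺ ∉ ideal J →
    ∃ λ (K : PrimeIdeal L) → ideal J ⊆ ideal K × x ∈ ideal K
  primeIdeal-above J {x} x∧x⁺∉J =
    let (I , I⊆ζJ , x′∉I) = primeIdeal-below (ζ-dual L em J) {x ′} λ [x′∨x′*]′∈J →
          x∧x⁺∉J (↓-closed J (≤-trans (∧-mono (≤-reflexive (sym (′-involutive x))) ≤-refl)
            (≤-reflexive (sym (′-∨ (x ′) (x ′ *))))) [x′∨x′*]′∈J)
    in ζ-dual L em I ,
       (λ {j} j∈J j′∈I → I⊆ζJ j′∈I (↓-closed J (≤-reflexive (′-involutive j)) j∈J)) ,
       x′∉I

  -- Chains of prime ideals and the identity.

  identity⇒noThreeChain : Identity → NoThreeChain (primeIdealPoset L)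
  identity⇒noThreeChain identity {I} {J} {K} I⊆J J⊆K
    with ⊆⊎witness (ideal J) (ideal I) | ⊆⊎witness (ideal K) (ideal J)
  ... | inj₁ J⊆I | _        = inj₁ (I⊆J , J⊆I)
  ... | inj₂ _   | inj₁ K⊆J = inj₂ (J⊆K , K⊆J)
  ... | inj₂ (y , y∈J , y∉I) | inj₂ (x , x∈K , x∉J) =
    ⊥-elim ([ x∉J , x⁺∉J ] (prime J (↓-closed J (identity x y) (∨-closed J y∈J (I⊆J y*∈I)))))
    where
    -- Primeness of `I` is applied to `y ∧ y *`, which is 0.
    y*∈I : y * ∈ ideal I
    y*∈I = [ ⊥-elim ∘ y∉I , id ] (prime I (↓-closed I (x∧x*≤0 y) (0∈ I)))

    -- Otherwise `K` would contain `x` and `x ⁺`, whose join is 1.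
    x⁺∉J : x ⁺ ∉ ideal J
    x⁺∉J x⁺∈J = 1∉ K (↓-closed K (1≤x∨x⁺ x) (∨-closed K x∈K (J⊆K x⁺∈J)))

  noThreeChain⇒identity : NoThreeChain (primeIdealPoset L) → Identity
  noThreeChain⇒identity noChain x y = decidable-stable em λ p≰q →
    let (J , q∈J , p∉J) = primeIdeal-separating p≰q
        (I , I⊆J , y∉I) = primeIdeal-below J q∈J
        (K , J⊆K , x∈K) = primeIdeal-above J p∉J
    -- The element `y` separates `I` from `J`, and `x` separates `J` from `K`.
    in [ (λ I≐J → y∉I (proj₂ I≐J (↓-closed J (x≤x∨y y (y *)) q∈J)))
       , (λ J≐K → p∉J (↓-closed J (x∧y≤x x (x ⁺)) (proj₂ J≐K x∈K)))
       ] (noChain {I} {J} {K} I⊆J J⊆K)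

theorem3p1 : (em : ∀ {a : Level} → ExcludedMiddle a) →
    (zorn : ∀ {a ℓ₁ ℓ₂ : Level} → ZornsLemma a ℓ₁ ℓ₂) →
    {c ℓ : Level} (L : PMAlgebra c ℓ) →
    Regular L ⇔ HeightAtMost (PMSpaceData.poset (dualSpace em L)) 1
theorem3p1 em zorn L = mk⇔
  (λ regular → noThreeChain⇒heightAtMost-1 (primeIdealPoset L)
    λ {I} {J} {K} → identity⇒noThreeChain em zorn L (regular⇒identity regular) {I} {J} {K})
  (λ height → identity⇒regular L (noThreeChain⇒identity em zorn L
    λ {I} {J} {K} → heightAtMost-1⇒noThreeChain (primeIdealPoset L) height {I} {J} {K}))
  where open PMAlgebraProperties L
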